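{- Let $n\ge 4$ and $s$ be integers with $2 \leq s \leq \lfloor\frac{n}{2}\rfloor$, and let $S_{n,s}$ be the spire graph. Then $$rn(S_{n,s}) \leq \begin{cases} 2k^2 -4k + 2s +3 & \text{if } n = 2k \text{ and } 2 \leq s \leq k-2,\\ 2k^2 -2k & \text{if } n = 2k \text{ and } s= k-1,\\ 2k^2 -2k + 1 & \text{if } n = 2k \text{ and } s= k,\\ 2k^2 -2k + 2s & \text{if } n = 2k + 1. \end{cases}$$
   Context: For a connected graph $G$, $d(u,v)$ denotes the graph distance and $\mathrm{diam}(G)$ the diameter. A radio labeling of $G$ is a function $c:V(G)\to\mathbb{Z}_{+}$ (positive integers; $0$ is not allowed) such that for all distinct $u,v\in V(G)$, $d(u,v)+|c(u)-c(v)|\ge \mathrm{diam}(G)+1$. The span of $c$ is the maximum value of $c$, and the radio number $rn(G)$ is the minimum span over all radio labelings of $G$. For integers $n\ge 4$ and $2\le s\le n-2$, the spire graph $S_{n,s}$ has vertices $v_1,\dots,v_n$ and edges $\{v_i,v_{i+1}\}$ for $i=1,\dots,n-2$ together with the edge $\{v_s,v_n\}$. -}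

module Defs where

open import Data.Nat using (ℕ; zero; suc; _+_; _*_; _∸_; _≤_; _<_; _≡ᵇ_; _<ᵇ_; _⊔_)
open import Data.Nat.Properties using (_≟_)
open import Data.Bool using (Bool; true; false; _∧_; _∨_; if_then_else_)
open import Data.Fin using (Fin; toℕ)
open import Data.Bool.ListAction using (any)
open import Data.List using (List; foldr; map; upTo; allFin; concatMap)
open import Data.Product using (Σ; _×_; ∃)
open import Relation.Binary.PropositionalEquality using (_≡_; _≢_)

Graph : ℕ → Set
Graph n = Fin n → Fin n → Bool

∣_-_∣ : ℕ → ℕ → ℕ
∣ a - b ∣ = (a ∸ b) ⊔ (b ∸ a)

_==ᶠ_ : {n : ℕ} → Fin n → Fin n → Bool
i ==ᶠ j = toℕ i ≡ᵇ toℕ j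

reach : {n : ℕ} → Graph n → ℕ → Fin n → Fin n → Bool
reach G zero    u v = u ==ᶠ v
reach G (suc k) u v = reach G k u v ∨ any (λ w → reach G k u w ∧ G w v) (allFin _)

-- least k in [from, from + fuel) with reach G k u v; returns from+fuel otherwise
firstReach : {n : ℕ} → Graph n → Fin n → Fin n → ℕ → ℕ → ℕ
firstReach G u v from zero       = from
firstReach G u v from (suc fuel) =
  if reach G from u v then from else firstReach G u v (suc from) fuel

-- Graph distance d(u,v): the least length of a walk (equivalently path)
-- from u to v.  For a connected graph on n vertices every distance is < n,
-- so the bounded search over lengths 0..n-1 is exact.
dist : {n : ℕ} → Graph n → Fin n → Fin n → ℕ
dist {n} G u v = firstReach G u v 0 n

diam : {n : ℕ} → Graph n → ℕ
diam {n} G = foldr _⊔_ 0 (concatMap (λ u → map (λ v → dist G u v) (allFin n)) (allFin n))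

IsRadioLabeling : {n : ℕ} → Graph n → (Fin n → ℕ) → Set
IsRadioLabeling {n} G c =
  ((v : Fin n) → 1 ≤ c v) ×
  ((u v : Fin n) → u ≢ v → suc (diam G) ≤ dist G u v + ∣ c u - c v ∣)

RadioNumberAtMost : {n : ℕ} → Graph n → ℕ → Set
RadioNumberAtMost {n} G B =
  Σ (Fin n → ℕ) λ c → IsRadioLabeling G c × ((v : Fin n) → c v ≤ B)

-- Spire graph S_{n,s}: vertex v_i (1 ≤ i ≤ n) is the element i-1 of Fin n.
-- Edges {v_i, v_{i+1}} for 1 ≤ i ≤ n-2, plus {v_s, v_n}.
spireEdge : ℕ → ℕ → ℕ → ℕ → Bool
spireEdge n s a b =
  ((suc a ≡ᵇ b) ∧ (b <ᵇ n ∸ 1))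
  ∨ ((a ≡ᵇ s ∸ 1) ∧ (b ≡ᵇ n ∸ 1))

spire : (n s : ℕ) → Graph n
spire n s i j = spireEdge n s (toℕ i) (toℕ j) ∨ spireEdge n s (toℕ j) (toℕ i)

{-# OPTIONS --safe #-}

-- List the vertices in order of increasing label, alternating between the two halves of the
-- path, and give consecutive vertices x, y the label difference diam + 1 - d(x, y), raised
-- by one where three consecutive vertices would otherwise conflict.  Apart from a few
-- exceptional vertices the list alternates between v_{x₀}, v_{x₀+1}, ... and
-- v_{y₀}, v_{y₀+1}, ..., so that the labels form two interleaved arithmetic progressions.
-- Their difference σ is at least diam, so along them only consecutive vertices need attention.

module Submission where

open import Defs
open import Data.Nat using (ℕ; _+_; _*_; _∸_; _≤_; _/_)
open import Data.Product using (_×_)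
open import Relation.Binary.PropositionalEquality using (_≡_)

open import Data.Nat using (zero; suc; pred; _<_; _≡ᵇ_; _<ᵇ_; _⊔_; z≤n; s≤s; s≤s⁻¹)
open import Data.Nat.Properties
open import Data.Nat.DivMod using (m/n*n≤m)
open import Data.Nat.Tactic.RingSolver using (solve)
open import Data.Bool using (true; false; T; _∧_)
open import Data.Bool.Properties using (T-≡; T-∧; T-∨)
open import Data.Empty using (⊥)
open import Data.Unit using (⊤; tt)
open import Data.Fin using (Fin; toℕ; fromℕ<)
open import Data.Fin.Properties using (toℕ<n; toℕ-fromℕ<; toℕ-injective)
open import Data.List using (List; []; _∷_; allFin; foldr)
open import Data.List.Relation.Unary.All as All using (All)
open import Data.List.Relation.Unary.All.Properties as All using ()
open import Data.List.Relation.Unary.Any as Any using (Any; here; there)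
open import Data.List.Relation.Unary.Any.Properties using (any⁺; any⁻)
open import Data.List.Membership.Propositional.Properties using (∈-allFin)
open import Data.List.Membership.Propositional using (_∈_; lose)
open import Data.Product as Product using (∃; _,_; proj₁; proj₂)
open import Data.Sum using (_⊎_; inj₁; inj₂; [_,_]′; swap)
open import Function using (_∘_; case_of_)
open import Function.Bundles using (Equivalence)
open import Relation.Binary.Definitions using (tri<; tri≈; tri>)
open import Relation.Nullary using (yes; no; contradiction)
open import Relation.Binary.PropositionalEquality using (refl; sym; trans; cong; subst; subst₂; _≢_)

open Equivalence using (to; from)

-- Walks and distances

-- The radio condition needs only one-sided estimates: an upper bound on the diameter, from explicit
-- walks, and lower bounds on distances, from 1-Lipschitz functions. No distance is computed
-- exactly. With D = diam + 1, a list with exact differences ends at the label 1 + (n - 1) D minus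
-- the sum of the distances between consecutive entries. Exact differences are consistent on
-- consecutive x, y, z iff d(x, y) + d(y, z) <= D + d(x, z); this is why the jumps in a ladder have
-- length about D / 2. A tip placed between two vertices to the right of v_s contributes two
-- distances, each falling by one when s grows by one: hence the term 2s. For n = 2k the general
-- formula would give 2k^2 - 2k + 1 at s = k - 1 and 2k^2 - 2k + 3 at s = k; other orders of the
-- vertices save one and two there, hence the separate cases.

module _ {n : ℕ} (G : Graph n) where

  reach-step : ∀ a {u w v} → T (reach G a u w) → T (G w v) → T (reach G (suc a) u v)
  reach-step a {w = w} r e =
    from T-∨ (inj₂ (any⁺ _ (lose (∈-allFin w) (from T-∧ (r , e)))))

  firstReach≤ : ∀ {u v} from fuel {m} → from ≤ m → T (reach G m u v) →
                firstReach G u v from fuel ≤ m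
  firstReach≤ i zero i≤m r = i≤m
  firstReach≤ {u} {v} i (suc fuel) i≤m r with reach G i u v in eq
  ... | true  = i≤m
  ... | false = firstReach≤ (suc i) fuel (≤∧≢⇒< i≤m λ { refl → subst T eq r }) r

  module _ {u} (δ : Fin n → ℕ) (δ-source : δ u ≡ 0)
           (δ-step : ∀ {w v} → T (G w v) → δ v ≤ suc (δ w)) where

    reach⇒≥ : ∀ a {v} → T (reach G a u v) → δ v ≤ a
    reach⇒≥ zero {v} r = ≤-reflexive
      (trans (cong δ (sym (toℕ-injective {i = u} {v} (≡ᵇ⇒≡ _ _ r)))) δ-source)
    reach⇒≥ (suc a) {v} r with to T-∨ r
    ... | inj₁ r′ = m≤n⇒m≤1+n (reach⇒≥ a r′)
    ... | inj₂ r′ with Any.satisfied (any⁻ _ (allFin n) r′)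
    ...   | w , h with to T-∧ h
    ...     | r″ , e = ≤-trans (δ-step e) (s≤s (reach⇒≥ a r″))

    -- An exhausted search returns `i + fuel` without having found a walk; the hypothesis bounds
    -- `δ v` by that default.
    firstReach≥ : ∀ {v} i fuel → δ v ≤ i + fuel → δ v ≤ firstReach G u v i fuel
    firstReach≥ {v} i zero le = subst (δ v ≤_) (+-identityʳ i) le
    firstReach≥ {v} i (suc fuel) le with reach G i u v in eq
    ... | true  = reach⇒≥ i (from T-≡ eq)
    ... | false = firstReach≥ (suc i) fuel (subst (δ v ≤_) (+-suc i fuel) le)

    dist≥ : ∀ {v} → δ v ≤ n → δ v ≤ dist G u v
    dist≥ = firstReach≥ 0 n

  module _ (f : Fin n → ℕ) (f-near : ∀ {w v} → T (G w v) → f w ≤ suc (f v) × f v ≤ suc (f w))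
           (f≤n : ∀ v → f v ≤ n) where

    -- The truncated differences `f u ∸ f _` and `f _ ∸ f u` vanish at u and grow by at most one per
    -- edge, so each can serve as `δ`. Both have source u, so symmetry of `dist` never comes up.
    dist-lipschitz : ∀ u v → f u ≤ dist G u v + f v × f v ≤ dist G u v + f u
    dist-lipschitz u v =
        m∸n≤o⇒m≤o+n (f u) (dist≥ (λ w → f u ∸ f w) (n∸n≡0 (f u))
          (λ {w} {x} e → ∸-step (f u) (f x)
            (≤-trans (m≤n+m∸n (f u) (f w)) (+-monoˡ-≤ _ (proj₁ (f-near e)))))
          (≤-trans (m∸n≤m (f u) (f v)) (f≤n u)))
      , m∸n≤o⇒m≤o+n (f v) (dist≥ (λ w → f w ∸ f u) (n∸n≡0 (f u))
          (λ {w} {x} e → m≤n+o⇒m∸n≤o (f x) (f u)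
            (≤-trans (proj₂ (f-near e)) (≤-trans (s≤s (m≤n+m∸n (f w) (f u)))
              (≤-reflexive (sym (+-suc (f u) _))))))
          (≤-trans (m∸n≤m (f v) (f u)) (f≤n v)))
      where
      m∸n≤o⇒m≤o+n : ∀ m {n o} → m ∸ n ≤ o → m ≤ o + n
      m∸n≤o⇒m≤o+n m {n} {o} le = ≤-trans (m≤n+m∸n m n)
        (≤-trans (+-monoʳ-≤ n le) (≤-reflexive (+-comm n o)))
      ∸-step : ∀ a b {c} → a ≤ suc (b + c) → a ∸ b ≤ suc c
      ∸-step a b {c} le = m≤n+o⇒m∸n≤o a b (≤-trans le (≤-reflexive (sym (+-suc b c))))

  dist-positive : ∀ {u v} → u ≢ v → 1 ≤ dist G u v
  dist-positive {u} {v} u≢v = positive n u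
    where
    from≤firstReach : ∀ i fuel → i ≤ firstReach G u v i fuel
    from≤firstReach i zero = ≤-refl
    from≤firstReach i (suc fuel) with reach G i u v
    ... | true  = ≤-refl
    ... | false = ≤-trans (n≤1+n i) (from≤firstReach (suc i) fuel)
    -- The inhabitant u of `Fin n` rules out a search without fuel, whose default would be 0.
    positive : ∀ fuel → Fin fuel → 1 ≤ firstReach G u v 0 fuel
    positive (suc fuel) _ with reach G 0 u v in eq
    ... | true  = contradiction (toℕ-injective (≡ᵇ⇒≡ _ _ (from T-≡ eq))) u≢v
    ... | false = from≤firstReach 1 fuel

  diam≤ : ∀ {B} → (∀ u v → dist G u v ≤ B) → diam G ≤ B
  diam≤ {B} le = max≤ (All.concat⁺ (All.map⁺ (All.tabulate {xs = allFin n}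
      λ {u} _ → All.map⁺ (All.tabulate {xs = allFin n} λ {v} _ → le u v))))
    where
    max≤ : ∀ {xs} → All (_≤ B) xs → foldr _⊔_ 0 xs ≤ B
    max≤ All.[]       = z≤n
    max≤ (p All.∷ ps) = ⊔-lub p (max≤ ps)

-- The metric of the spire graph

-- path p is v_p (1 ≤ p ≤ n - 1) and tip is v_n.  Below D = n - 1 = diam + 1.
data Vertex : Set where
  path : ℕ → Vertex
  tip  : Vertex

vertexAt : ℕ → ℕ → Vertex
vertexAt D a with a <? D
... | yes _ = path (suc a)
... | no  _ = tip

vertexAt-path : ∀ {D a} → a < D → vertexAt D a ≡ path (suc a)
vertexAt-path {D} {a} a<D with a <? D
... | yes _   = refl
... | no  a≮D = contradiction a<D a≮D

vertexAt-tip : ∀ D → vertexAt D D ≡ tip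
vertexAt-tip D with D <? D
... | yes D<D = contradiction D<D (<-irrefl refl)
... | no  _   = refl

-- Two ways of laying the spire out on a line, with the tip beyond v_s on either side
-- (leftward shifts all positions by one to avoid subtraction).  Both are
-- 1-Lipschitz, and the distance from the tip to a path vertex is witnessed by one of them.
leftward rightward : ℕ → Vertex → ℕ
leftward s (path p) = suc p
leftward s tip      = s
rightward s (path p) = p
rightward s tip      = suc s

-- All that the label arithmetic knows about the distance d of x and y. Keeping d abstract allows a
-- pair of path vertices to be translated with d fixed, as in `shift`.
record Bounds (s : ℕ) (x y : Vertex) (d : ℕ) : Set where
  field
    positive : 1 ≤ d
    leftˣ    : leftward s x ≤ d + leftward s y
    leftʸ    : leftward s y ≤ d + leftward s x
    rightˣ   : rightward s x ≤ d + rightward s y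
    rightʸ   : rightward s y ≤ d + rightward s x

open Bounds

Bounds-sym : ∀ {s x y d} → Bounds s x y d → Bounds s y x d
Bounds-sym b = record
  { positive = positive b
  ; leftˣ = leftʸ b ; leftʸ = leftˣ b ; rightˣ = rightʸ b ; rightʸ = rightˣ b }

module _ {D s : ℕ} (2≤s : 2 ≤ s) (s<D : s < D) where

  private
    G : Graph (suc D)
    G = spire (suc D) s

    vertex : Fin (suc D) → Vertex
    vertex u = vertexAt D (toℕ u)

    1≤s : 1 ≤ s
    1≤s = ≤-trans (n≤1+n 1) 2≤s

    suc[s∸1]≡s : suc (s ∸ 1) ≡ s
    suc[s∸1]≡s = m+[n∸m]≡n 1≤s

    s∸1<D : s ∸ 1 < D
    s∸1<D = subst (_≤ D) (sym suc[s∸1]≡s) (<⇒≤ s<D)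

    data Edge : ℕ → ℕ → Set where
      along : ∀ {a} → suc a < D → Edge a (suc a)
      spike : Edge (s ∸ 1) D

    spireEdge⇒Edge : ∀ a b → T (spireEdge (suc D) s a b) → Edge a b
    spireEdge⇒Edge a b e with to T-∨ e
    ... | inj₁ e′ with to T-∧ e′
    ...   | p , q with ≡ᵇ⇒≡ (suc a) b p
    ...     | refl = along (<ᵇ⇒< _ _ q)
    spireEdge⇒Edge a b e | inj₂ e′ with to T-∧ e′
    ...   | p , q with ≡ᵇ⇒≡ a (s ∸ 1) p | ≡ᵇ⇒≡ b D q
    ...     | refl | refl = spike

    Edge⇒spireEdge : ∀ {a b} → Edge a b → T (spireEdge (suc D) s a b)
    Edge⇒spireEdge (along {a} lt) = from T-∨ (inj₁ (from T-∧ (≡⇒≡ᵇ a a refl , <⇒<ᵇ lt)))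
    Edge⇒spireEdge spike =
      from (T-∨ {(suc (s ∸ 1) ≡ᵇ D) ∧ (D <ᵇ D)})
        (inj₂ (from T-∧ (≡⇒≡ᵇ (s ∸ 1) _ refl , ≡⇒≡ᵇ D D refl)))

    edge⁺ : ∀ u v → Edge (toℕ u) (toℕ v) ⊎ Edge (toℕ v) (toℕ u) → T (G u v)
    edge⁺ u v (inj₁ e) = from T-∨ (inj₁ (Edge⇒spireEdge e))
    edge⁺ u v (inj₂ e) =
      from (T-∨ {spireEdge (suc D) s (toℕ u) (toℕ v)}) (inj₂ (Edge⇒spireEdge e))

    edge⁻ : ∀ {u v} → T (G u v) → Edge (toℕ u) (toℕ v) ⊎ Edge (toℕ v) (toℕ u)
    edge⁻ {u} {v} e with to T-∨ e
    ... | inj₁ e′ = inj₁ (spireEdge⇒Edge (toℕ u) (toℕ v) e′)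
    ... | inj₂ e′ = inj₂ (spireEdge⇒Edge (toℕ v) (toℕ u) e′)

    Near : ℕ → ℕ → Set
    Near a b = a ≤ suc b × b ≤ suc a

    module _ (φ : Vertex → ℕ) (φ-path : ∀ p → Near (φ (path p)) (φ (path (suc p))))
             (φ-tip : Near (φ (path s)) (φ tip)) (φ≤ : ∀ {a} → a < D → φ (path (suc a)) ≤ suc D)
             (φ-tip≤ : φ tip ≤ suc D) where

      Edge-near : ∀ {a b} → Edge a b → Near (φ (vertexAt D a)) (φ (vertexAt D b))
      Edge-near (along {a} lt)
        rewrite vertexAt-path (<-trans (n<1+n a) lt) | vertexAt-path lt = φ-path (suc a)
      Edge-near spike
        rewrite vertexAt-path s∸1<D | vertexAt-tip D | suc[s∸1]≡s = φ-tip

      vertex-lipschitz : ∀ u v → φ (vertex u) ≤ dist G u v + φ (vertex v)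
                                × φ (vertex v) ≤ dist G u v + φ (vertex u)
      vertex-lipschitz = dist-lipschitz G (φ ∘ vertex)
        (λ e → [ Edge-near , Product.swap ∘ Edge-near ]′ (edge⁻ e)) φ≤suc
        where
        φ≤suc : ∀ v → φ (vertex v) ≤ suc D
        φ≤suc v with toℕ v <? D
        ... | yes lt = φ≤ lt
        ... | no _   = φ-tip≤

  dist-bounds : ∀ {u v} → u ≢ v → Bounds s (vertex u) (vertex v) (dist G u v)
  dist-bounds {u} {v} u≢v = record
    { positive = dist-positive G u≢v
    ; leftˣ = proj₁ left ; leftʸ = proj₂ left ; rightˣ = proj₁ right ; rightʸ = proj₂ right }
    where
    left = vertex-lipschitz (leftward s)
      (λ p → m≤n⇒m≤1+n (n≤1+n _) , ≤-refl) (≤-refl , m≤n⇒m≤1+n (n≤1+n s))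
      s≤s (m≤n⇒m≤1+n (<⇒≤ s<D)) u v
    right = vertex-lipschitz (rightward s)
      (λ p → m≤n⇒m≤1+n (n≤1+n _) , ≤-refl) (m≤n⇒m≤1+n (n≤1+n s) , ≤-refl)
      m≤n⇒m≤1+n (m≤n⇒m≤1+n s<D) u v

  private
    walk-right : ∀ m {a u v w} → T (reach G a u v) → toℕ w < D → toℕ w ≡ m + toℕ v →
                 T (reach G (m + a) u w)
    walk-right zero {a} {u} {v} r w<D eq = subst (T ∘ reach G a u) (toℕ-injective (sym eq)) r
    walk-right (suc m) {a} {u} {v} {w} r w<D eq =
      reach-step G (m + a) {u} {w′} {w}
        (walk-right m {a} {u} {v} {w′} r (subst (_< D) (sym w′≡) w′<D) w′≡)
        (edge⁺ w′ w (inj₁ (subst₂ Edge (sym w′≡) (sym eq) (along (subst (_< D) eq w<D)))))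
      where
      w′<D : m + toℕ v < D
      w′<D = <-trans (n<1+n _) (subst (_< D) eq w<D)
      w′ : Fin (suc D)
      w′ = fromℕ< (m≤n⇒m≤1+n w′<D)
      w′≡ : toℕ w′ ≡ m + toℕ v
      w′≡ = toℕ-fromℕ< (m≤n⇒m≤1+n w′<D)

    walk-left : ∀ m {a u v w} → T (reach G a u v) → toℕ v < D → toℕ v ≡ m + toℕ w →
                T (reach G (m + a) u w)
    walk-left zero {a} {u} {v} r v<D eq = subst (T ∘ reach G a u) (toℕ-injective eq) r
    walk-left (suc m) {a} {u} {v} {w} r v<D eq =
      reach-step G (m + a) {u} {w′} {w}
        (walk-left m {a} {u} {v} {w′} r v<D
          (trans eq (trans (sym (+-suc m _)) (cong (m +_) (sym w′≡)))))
        (edge⁺ w′ w (inj₂ (subst (Edge (toℕ w)) (sym w′≡) (along w′<D))))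
      where
      w′<D : suc (toℕ w) < D
      w′<D = ≤-<-trans (s≤s (m≤n+m (toℕ w) m)) (subst (_< D) eq v<D)
      w′ : Fin (suc D)
      w′ = fromℕ< (m≤n⇒m≤1+n w′<D)
      w′≡ : toℕ w′ ≡ suc (toℕ w)
      w′≡ = toℕ-fromℕ< (m≤n⇒m≤1+n w′<D)

    -- The initial walk is arbitrary so that a walk leaving the tip can first take the edge to
    -- `base`, with `a = 1`.
    walk : ∀ {a u v w} → T (reach G a u v) → toℕ v < D → toℕ w < D →
           ∃ λ m → T (reach G (m + a) u w) × (toℕ w ≡ m + toℕ v ⊎ toℕ v ≡ m + toℕ w)
    walk {a} {u} {v} {w} r v<D w<D with ≤-total (toℕ v) (toℕ w)
    ... | inj₁ v≤w = _ , walk-right (toℕ w ∸ toℕ v) {a} {u} {v} {w} r w<D eq , inj₁ eq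
      where eq = sym (m∸n+n≡m v≤w)
    ... | inj₂ w≤v = _ , walk-left (toℕ v ∸ toℕ w) {a} {u} {v} {w} r v<D eq , inj₂ eq
      where eq = sym (m∸n+n≡m w≤v)

    base : Fin (suc D)
    base = fromℕ< (m≤n⇒m≤1+n s∸1<D)

    base≡ : toℕ base ≡ s ∸ 1
    base≡ = toℕ-fromℕ< (m≤n⇒m≤1+n s∸1<D)

    base<D : toℕ base < D
    base<D = subst (_< D) (sym base≡) s∸1<D

    base-edge : {v : Fin (suc D)} → toℕ v ≡ D → Edge (toℕ base) (toℕ v)
    base-edge v≡D = subst₂ Edge (sym base≡) (sym v≡D) spike

    reach-refl : (u : Fin (suc D)) → T (reach G 0 u u)
    reach-refl u = ≡⇒≡ᵇ (toℕ u) (toℕ u) refl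

    reach⇒dist< : ∀ {u v} m → m < D → T (reach G m u v) → dist G u v < D
    reach⇒dist< m m<D r = ≤-<-trans (firstReach≤ G 0 (suc D) {m} z≤n r) m<D

    path-length<D : ∀ {a b} m → a < D → b < D → a ≡ m + b ⊎ b ≡ m + a → m < D
    path-length<D {b = b} m a<D b<D (inj₁ refl) = ≤-<-trans (m≤m+n m b) a<D
    path-length<D {a = a} m a<D b<D (inj₂ refl) = ≤-<-trans (m≤m+n m a) b<D

    -- The extra step to the tip is affordable because v_s is an inner vertex of the path: `2 ≤ s`
    -- leaves room to its left, for targets on its right, and `s < D` leaves room to its right.
    base-length<D : ∀ {a} m → a < D → a ≡ m + toℕ base ⊎ toℕ base ≡ m + a → suc m < D
    base-length<D {a} m a<D e rewrite base≡ with e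
    ... | inj₁ refl = ≤-trans (s≤s (≤-trans (≤-reflexive (+-comm 1 m))
                        (+-monoʳ-≤ m (s≤s⁻¹ (subst (2 ≤_) (sym suc[s∸1]≡s) 2≤s))))) a<D
    ... | inj₂ eq = ≤-<-trans (≤-trans (s≤s (≤-trans (m≤m+n m a) (≤-reflexive (sym eq))))
                        (≤-reflexive suc[s∸1]≡s)) s<D

  dist<D : ∀ u v → dist G u v < D
  dist<D u v with m≤n⇒m<n∨m≡n (s≤s⁻¹ (toℕ<n u)) | m≤n⇒m<n∨m≡n (s≤s⁻¹ (toℕ<n v))
  ... | inj₁ u<D | inj₁ v<D with walk {0} {u} {u} {v} (reach-refl u) u<D v<D
  ...   | m , r , e = reach⇒dist< _ (subst (_< D) (sym (+-identityʳ m)) (path-length<D m v<D u<D e)) r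
  dist<D u v | inj₁ u<D | inj₂ v≡D with walk {0} {u} {u} {base} (reach-refl u) u<D base<D
  ...   | m , r , e = reach⇒dist< (suc (m + 0))
          (subst (λ j → suc j < D) (sym (+-identityʳ m)) (base-length<D m u<D (swap e)))
          (reach-step G (m + 0) {u} {base} {v} r (edge⁺ base v (inj₁ (base-edge {v} v≡D))))
  dist<D u v | inj₂ u≡D | inj₁ v<D
    with walk {1} {u} {base} {v}
           (reach-step G 0 {u} {u} {base} (reach-refl u) (edge⁺ u base (inj₂ (base-edge {u} u≡D))))
           base<D v<D
  ...   | m , r , e = reach⇒dist< (m + 1) (subst (_< D) (+-comm 1 m) (base-length<D m v<D e)) r
  dist<D u v | inj₂ u≡D | inj₂ v≡D =
    reach⇒dist< {u} {v} 0 (≤-trans (s≤s z≤n) s<D)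
      (subst (T ∘ reach G 0 u) (toℕ-injective (trans u≡D (sym v≡D))) (reach-refl u))

  diam<D : diam G < D
  diam<D = subst (suc (diam G) ≤_) (m+[n∸m]≡n 1≤D) (s≤s (diam≤ G λ u v →
             s≤s⁻¹ (subst (dist G u v <_) (sym (m+[n∸m]≡n 1≤D)) (dist<D u v))))
    where
    1≤D : 1 ≤ D
    1≤D = ≤-trans (s≤s z≤n) s<D

-- Labelings built from single vertices and ladders

pad : ∀ {m n} e → m + e ≡ n → m ≤ n
pad {m} e refl = m≤m+n m e

module Separation (s D : ℕ) where

  -- A record rather than a function, so that the vertices and labels can be inferred.
  record Separates (x : Vertex) (l : ℕ) (y : Vertex) (m : ℕ) : Set where
    constructor separates
    field separate : ∀ {d} → Bounds s x y d → D + l ≤ d + m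

  open Separates

  far : ∀ {x l y m} → D + l ≤ suc m → Separates x l y m
  far {m = m} le = separates λ b → ≤-trans le (+-monoˡ-≤ m (positive b))

  private
    via : ∀ {u v d l m} e → v ≤ d + u → D + l + u + e ≡ m + v → D + l ≤ d + m
    via {u} {v} {d} {l} {m} e v≤d+u eq = +-cancelʳ-≤ u (D + l) (d + m) (begin
      D + l + u   ≤⟨ pad e eq ⟩
      m + v       ≤⟨ +-monoʳ-≤ m v≤d+u ⟩
      m + (d + u) ≡⟨ solve (m ∷ d ∷ u ∷ []) ⟩
      d + m + u   ∎)
      where open ≤-Reasoning

  -- Here and in the next four lemmas `e` is the slack: the excess of the label difference over D
  -- minus the lower bound on the distance. Slack 0 marks an exact fit.
  ascending : ∀ {a b l m} e → D + l + a + e ≡ m + b → Separates (path a) l (path b) m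
  ascending e eq = separates λ b → via e (rightʸ b) eq

  descending : ∀ {a b l m} e → D + l + b + e ≡ m + a → Separates (path a) l (path b) m
  descending e eq = separates λ b → via e (rightˣ b) eq

  into-tip : ∀ {a l m} e → D + l + s + e ≡ m + suc a → Separates (path a) l tip m
  into-tip e eq = separates λ b → via e (leftˣ b) eq

  from-tip-right : ∀ {a l m} e → D + l + s + e ≡ m + suc a → Separates tip l (path a) m
  from-tip-right e eq = separates λ b → via e (leftʸ b) eq

  from-tip-left : ∀ {a l m} e → D + l + a + e ≡ m + suc s → Separates tip l (path a) m
  from-tip-left e eq = separates λ b → via e (rightˣ b) eq

  -- The bounds on path vertices depend only on differences of positions, so one rung and one step
  -- of a ladder decide all the others.
  shift : ∀ {a b l m} i c → Separates (path a) l (path b) m →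
          Separates (path (i + a)) (c + l) (path (i + b)) (c + m)
  shift {a} {b} {l} {m} i c sep = separates λ {d} bd → begin
    D + (c + l) ≡⟨ swap-+ D c l ⟩
    c + (D + l) ≤⟨ +-monoʳ-≤ c (separate sep (unshifted bd)) ⟩
    c + (d + m) ≡⟨ swap-+ c d m ⟩
    d + (c + m) ∎
    where
    open ≤-Reasoning
    swap-+ : ∀ x y z → x + (y + z) ≡ y + (x + z)
    swap-+ x y z = solve (x ∷ y ∷ z ∷ [])
    cancel : ∀ d {x y} → i + x ≤ d + (i + y) → x ≤ d + y
    cancel d {x} {y} le = +-cancelˡ-≤ i x (d + y) (≤-trans le (≤-reflexive (swap-+ d i y)))
    cancel-suc : ∀ d {x y} → suc (i + x) ≤ d + suc (i + y) → suc x ≤ d + suc y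
    cancel-suc d {x} {y} le = cancel d
      (subst₂ (λ u v → u ≤ d + v) (sym (+-suc i x)) (sym (+-suc i y)) le)
    unshifted : ∀ {d} → Bounds s (path (i + a)) (path (i + b)) d → Bounds s (path a) (path b) d
    unshifted {d} bd = record
      { positive = positive bd
      ; leftˣ = cancel-suc d (leftˣ bd) ; leftʸ = cancel-suc d (leftʸ bd)
      ; rightˣ = cancel d (rightˣ bd) ; rightʸ = cancel d (rightʸ bd) }

  Before : (X Y : Vertex → ℕ → Set) → Set
  Before X Y = ∀ {x l y m} → X x l → Y y m → Separates x l y m

  Separated : (X : Vertex → ℕ → Set) → Set
  Separated X = ∀ {x l y m} → X x l → X y m → x ≢ y → ∀ {d} → Bounds s x y d →
                D + l ≤ d + m ⊎ D + m ≤ d + l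

  data At (x : Vertex) (l : ℕ) : Vertex → ℕ → Set where
    at : At x l x l

  data Ladder (x₀ α y₀ β σ N : ℕ) : Vertex → ℕ → Set where
    lo : ∀ {i} → i < N → Ladder x₀ α y₀ β σ N (path (i + x₀)) (i * σ + α)
    hi : ∀ {i} → i < N → Ladder x₀ α y₀ β σ N (path (i + y₀)) (i * σ + β)

  module _ {x₀ α y₀ β σ : ℕ} (D≤1+σ : D ≤ suc σ) (α≤β : α ≤ β) where

    private
      -- The `suc` on the right is the least distance of distinct vertices: one index up adds σ ≥ D
      -- - 1 to the label, and distance 1 supplies the rest.
      climb : ∀ {i j c e} → i < j → c ≤ e → D + (i * σ + c) ≤ suc (j * σ + e)
      climb {i} {j} {c} {e} i<j c≤e = begin
        D + (i * σ + c)     ≤⟨ +-mono-≤ D≤1+σ (+-monoʳ-≤ (i * σ) c≤e) ⟩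
        suc σ + (i * σ + e) ≡⟨ cong suc (sym (+-assoc σ (i * σ) e)) ⟩
        suc (suc i * σ + e) ≤⟨ s≤s (+-monoˡ-≤ e (*-monoˡ-≤ σ i<j)) ⟩
        suc (j * σ + e)     ∎
        where open ≤-Reasoning

    -- A pair is a translate of `rung` (`lo` and `hi` of equal index), a translate of `step` (`hi`
    -- and the next `lo`), or far enough apart in label for `climb`.
    ladder-separated : ∀ {N} → β ≤ σ + α →
      Separates (path x₀) α (path y₀) β → Separates (path y₀) β (path (suc x₀)) (σ + α) →
      Separated (Ladder x₀ α y₀ β σ N)
    ladder-separated {N} β≤σ+α rung step = cases
      where
      lo-hi : ∀ i j {d} → Bounds s (path (i + x₀)) (path (j + y₀)) d →
              D + (i * σ + α) ≤ d + (j * σ + β) ⊎ D + (j * σ + β) ≤ d + (i * σ + α)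
      lo-hi i j {d} b with <-cmp i j
      ... | tri< i<j _ _  = inj₁ (separate (far (climb i<j α≤β)) b)
      ... | tri≈ _ refl _ = inj₁ (separate (shift i (i * σ) rung) b)
      ... | tri> _ _ j<i with m≤n⇒m<n∨m≡n j<i
      ...   | inj₂ refl = inj₂ (subst (λ e → D + (j * σ + β) ≤ d + e) regroup
                (separate (shift j (j * σ) step) (Bounds-sym
                  (subst (λ p → Bounds s (path p) (path (j + y₀)) d) (sym (+-suc j x₀)) b))))
        where
        regroup : j * σ + (σ + α) ≡ σ + j * σ + α
        regroup = solve (j ∷ σ ∷ α ∷ [])
      -- Here `lo` is at least two indices above `hi`. Its label is read as `i * σ + (σ + α)`, and
      -- `β ≤ σ + α` lets `climb` go from j to i.
      lo-hi (suc i) j b | tri> _ _ _ | inj₁ (s≤s j<i) = inj₂ (separate (far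
        (≤-trans (climb j<i β≤σ+α) (≤-reflexive (cong suc regroup)))) (Bounds-sym b))
        where
        regroup : i * σ + (σ + α) ≡ σ + i * σ + α
        regroup = solve (i ∷ σ ∷ α ∷ [])

      same : ∀ {a c} i j → path (i + a) ≢ path (j + a) → ∀ {d} →
             Bounds s (path (i + a)) (path (j + a)) d →
             D + (i * σ + c) ≤ d + (j * σ + c) ⊎ D + (j * σ + c) ≤ d + (i * σ + c)
      same i j x≢y b with <-cmp i j
      ... | tri< i<j _ _  = inj₁ (separate (far (climb i<j ≤-refl)) b)
      ... | tri≈ _ refl _ = contradiction refl x≢y
      ... | tri> _ _ j<i  = inj₂ (separate (far (climb j<i ≤-refl)) (Bounds-sym b))

      cases : Separated (Ladder x₀ α y₀ β σ N)
      cases (lo {i} _) (lo {j} _) x≢y b = same i j x≢y b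
      cases (hi {i} _) (hi {j} _) x≢y b = same i j x≢y b
      cases (lo {i} _) (hi {j} _) x≢y b = lo-hi i j b
      cases (hi {i} _) (lo {j} _) x≢y b = swap (lo-hi j i (Bounds-sym b))

    At-before-ladder : ∀ {x l N} → l ≤ α → Separates x l (path x₀) α → Separates x l (path y₀) β →
                       Before (At x l) (Ladder x₀ α y₀ β σ N)
    At-before-ladder l≤α f g = λ where
      at (lo {zero} _)  → f
      at (hi {zero} _)  → g
      at (lo {suc i} _) → far (climb {0} {suc i} (s≤s z≤n) l≤α)
      at (hi {suc i} _) → far (climb {0} {suc i} (s≤s z≤n) (≤-trans l≤α α≤β))

    ladder-before-At : ∀ {y m M} → M * σ + β ≤ m →
      Separates (path (M + x₀)) (M * σ + α) y m → Separates (path (M + y₀)) (M * σ + β) y m →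
      Before (Ladder x₀ α y₀ β σ (suc M)) (At y m)
    ladder-before-At {y} {m} {M} le f g = cases
      where
      cases : Before (Ladder x₀ α y₀ β σ (suc M)) (At y m)
      cases (lo i<1+M) at with m≤n⇒m<n∨m≡n (s≤s⁻¹ i<1+M)
      ... | inj₁ i<M  = far (≤-trans (climb i<M α≤β) (s≤s le))
      ... | inj₂ refl = f
      cases (hi i<1+M) at with m≤n⇒m<n∨m≡n (s≤s⁻¹ i<1+M)
      ... | inj₁ i<M  = far (≤-trans (climb i<M ≤-refl) (s≤s le))
      ... | inj₂ refl = g

  -- Lists of pieces and the radio labelings they define

  data Piece : Set where
    single : Vertex → ℕ → Piece
    ladder : (x₀ α y₀ β σ N : ℕ) → Piece

  ⟦_⟧ : Piece → Vertex → ℕ → Set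
  ⟦ single x l ⟧            = At x l
  ⟦ ladder x₀ α y₀ β σ N ⟧ = Ladder x₀ α y₀ β σ N

  -- A relation rather than a function: separation is proved for every choice of labels of two
  -- distinct vertices, so any label found through `Covers` will do and disjointness of the pieces
  -- is never an issue.
  Labels : List Piece → Vertex → ℕ → Set
  Labels ps x l = Any (λ p → ⟦ p ⟧ x l) ps

  record Covers (ps : List Piece) (a b : ℕ) : Set where
    constructor covering
    field cover : ∀ {p} → a ≤ p → p < b → ∃ (Labels ps (path p))

  open Covers

  infixr 5 _⟫_
  _⟫_ : ∀ {ps a b c} → Covers ps a b → Covers ps b c → Covers ps a c
  _⟫_ {b = b} f g = covering λ {p} a≤p p<c → case p <? b of λ where
    (yes p<b) → cover f a≤p p<b
    (no  p≮b) → cover g (≮⇒≥ p≮b) p<c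

  single-covers : ∀ {ps p l} → single (path p) l ∈ ps → Covers ps p (suc p)
  single-covers {l = l} s∈ps = covering λ p≤q q<1+p →
    l , Any.map (λ { refl → subst (λ q → At _ _ (path q) l)
                              (≤-antisym p≤q (s≤s⁻¹ q<1+p)) at }) s∈ps

  private
    offset : ∀ {a N p} → a ≤ p → p < N + a → ∃ λ i → i < N × i + a ≡ p
    offset {a} {N} {p} a≤p p<N+a = p ∸ a , +-cancelʳ-< a (p ∸ a) N
      (subst (_< N + a) (sym (m∸n+n≡m a≤p)) p<N+a) , m∸n+n≡m a≤p

  lo-covers : ∀ {ps x₀ α y₀ β σ N} → ladder x₀ α y₀ β σ N ∈ ps → Covers ps x₀ (N + x₀)
  lo-covers l∈ps = covering λ le lt → case offset le lt of λ where
    (_ , i<N , refl) → _ , Any.map (λ { refl → lo i<N }) l∈ps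

  hi-covers : ∀ {ps x₀ α y₀ β σ N} → ladder x₀ α y₀ β σ N ∈ ps → Covers ps y₀ (N + y₀)
  hi-covers l∈ps = covering λ le lt → case offset le lt of λ where
    (_ , i<N , refl) → _ , Any.map (λ { refl → hi i<N }) l∈ps

  -- Inner and Precedes collect finitely many inequalities that suffice for separation: by
  -- D ≤ 1 + σ, all but adjacent members of a ladder are far apart.
  Inner : Piece → Set
  Inner (single _ _)            = ⊤
  Inner (ladder x₀ α y₀ β σ N) =
    D ≤ suc σ × α ≤ β × β ≤ σ + α ×
    Separates (path x₀) α (path y₀) β × Separates (path y₀) β (path (suc x₀)) (σ + α)

  Precedes : Piece → Piece → Set
  Precedes (single x l) (single y m)            = Separates x l y m
  Precedes (single x l) (ladder x₀ α y₀ β σ N) =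
    l ≤ α × Separates x l (path x₀) α × Separates x l (path y₀) β
  Precedes (ladder x₀ α y₀ β σ zero) (single y m) = ⊤
  Precedes (ladder x₀ α y₀ β σ (suc M)) (single y m) =
    M * σ + β ≤ m × Separates (path (M + x₀)) (M * σ + α) y m
                  × Separates (path (M + y₀)) (M * σ + β) y m
  -- Every list below contains a single ladder.
  Precedes (ladder _ _ _ _ _ _) (ladder _ _ _ _ _ _) = ⊥

  PrecedesAll : Piece → List Piece → Set
  PrecedesAll p []       = ⊤
  PrecedesAll p (q ∷ qs) = Precedes p q × PrecedesAll p qs

  Ordered : List Piece → Set
  Ordered []       = ⊤
  Ordered (p ∷ ps) = Inner p × PrecedesAll p ps × Ordered ps

  Inner⇒Separated : ∀ p → Inner p → Separated ⟦ p ⟧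
  Inner⇒Separated (single _ _) _ at at x≢x = contradiction refl x≢x
  Inner⇒Separated (ladder _ _ _ _ _ _) (D≤1+σ , α≤β , β≤σ+α , rung , step) =
    ladder-separated D≤1+σ α≤β β≤σ+α rung step

  Precedes⇒Before : ∀ p q → Inner p → Inner q → Precedes p q → Before ⟦ p ⟧ ⟦ q ⟧
  Precedes⇒Before (single _ _) (single _ _) _ _ sep at at = sep
  Precedes⇒Before (single _ _) (ladder _ _ _ _ _ _) _ (D≤1+σ , α≤β , _) (l≤α , f , g) =
    At-before-ladder D≤1+σ α≤β l≤α f g
  Precedes⇒Before (ladder _ _ _ _ _ zero) (single _ _) _ _ _ (lo ())
  Precedes⇒Before (ladder _ _ _ _ _ zero) (single _ _) _ _ _ (hi ())
  Precedes⇒Before (ladder _ _ _ _ _ (suc _)) (single _ _) (D≤1+σ , α≤β , _) _ (le , f , g) =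
    ladder-before-At D≤1+σ α≤β le f g

  PrecedesAll⇒Before : ∀ p qs → Inner p → PrecedesAll p qs → Ordered qs →
                       Before ⟦ p ⟧ (Labels qs)
  PrecedesAll⇒Before p (q ∷ _) i (pq , _) (j , _) x (here y) = Precedes⇒Before p q i j pq x y
  PrecedesAll⇒Before p (_ ∷ qs) i (_ , pqs) (_ , _ , o) x (there y) =
    PrecedesAll⇒Before p qs i pqs o x y

  Ordered⇒Separated : ∀ ps → Ordered ps → Separated (Labels ps)
  Ordered⇒Separated (p ∷ _) (i , _) (here x) (here y) x≢y b = Inner⇒Separated p i x y x≢y b
  Ordered⇒Separated (p ∷ ps) (i , pps , o) (here x) (there y) x≢y b =
    inj₁ (separate (PrecedesAll⇒Before p ps i pps o x y) b)
  Ordered⇒Separated (p ∷ ps) (i , pps , o) (there x) (here y) x≢y b =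
    inj₂ (separate (PrecedesAll⇒Before p ps i pps o y x) (Bounds-sym b))
  Ordered⇒Separated (_ ∷ ps) (_ , _ , o) (there x) (there y) x≢y b =
    Ordered⇒Separated ps o x y x≢y b

  Within : ℕ → List Piece → Set
  Within B []                            = ⊤
  Within B (single x l ∷ ps)             = 1 ≤ l × l ≤ B × Within B ps
  Within B (ladder x₀ α y₀ β σ N ∷ ps) =
    -- The last inequality bounds the top label `(N - 1) σ + β` by B, written without subtraction.
    1 ≤ α × α ≤ β × N * σ + β ≤ σ + B × Within B ps

  ladder-bounded : ∀ {x₀ α y₀ β σ N B} → 1 ≤ α → α ≤ β → N * σ + β ≤ σ + B →
                   ∀ {x l} → Ladder x₀ α y₀ β σ N x l → 1 ≤ l × l ≤ B
  ladder-bounded {α = α} {β = β} {σ} {N} {B} 1≤α α≤β le = λ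
    { (lo {i} i<N) → ≤-trans 1≤α (m≤n+m α (i * σ)) , ≤-trans (+-monoʳ-≤ (i * σ) α≤β) (hi≤B i i<N)
    ; (hi {i} i<N) → ≤-trans (≤-trans 1≤α α≤β) (m≤n+m β (i * σ)) , hi≤B i i<N }
    where
    hi≤B : ∀ i → i < N → i * σ + β ≤ B
    hi≤B i i<N = +-cancelˡ-≤ σ _ _ (≤-trans (≤-reflexive (sym (+-assoc σ (i * σ) β)))
      (≤-trans (+-monoˡ-≤ β (*-monoˡ-≤ σ i<N)) le))

  Within⇒bounded : ∀ {B} ps → Within B ps → ∀ {x l} → Labels ps x l → 1 ≤ l × l ≤ B
  Within⇒bounded (single _ _ ∷ _) (1≤l , l≤B , _) (here at) = 1≤l , l≤B
  Within⇒bounded (single _ _ ∷ ps) (_ , _ , w) (there x) = Within⇒bounded ps w x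
  Within⇒bounded (ladder _ _ _ _ _ _ ∷ _) (1≤α , α≤β , le , _) (here x) =
    ladder-bounded 1≤α α≤β le x
  Within⇒bounded (ladder _ _ _ _ _ _ ∷ ps) (_ , _ , _ , w) (there x) = Within⇒bounded ps w x

  radioNumberAtMost : ∀ {B} ps → 2 ≤ s → s < D → Ordered ps → Covers ps 1 (suc D) →
                      ∃ (λ l → single tip l ∈ ps) → Within B ps →
                      RadioNumberAtMost (spire (suc D) s) B
  radioNumberAtMost {B} ps 2≤s s<D ordered covers (_ , tip∈ps) within =
    label , ((λ v → proj₁ (bounded (proj₂ (labelled (toℕ v))))) , condition) ,
    λ v → proj₂ (bounded (proj₂ (labelled (toℕ v))))
    where
    bounded : ∀ {x l} → Labels ps x l → 1 ≤ l × l ≤ B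
    bounded = Within⇒bounded ps within

    labelled : ∀ a → ∃ (Labels ps (vertexAt D a))
    labelled a with a <? D
    ... | yes a<D = cover covers (s≤s z≤n) (s≤s a<D)
    ... | no  _   = _ , Any.map (λ { refl → at }) tip∈ps

    label : Fin (suc D) → ℕ
    label v = proj₁ (labelled (toℕ v))

    index : Vertex → ℕ
    index (path p) = pred p
    index tip      = D

    index-vertexAt : ∀ {a} → a ≤ D → index (vertexAt D a) ≡ a
    index-vertexAt {a} a≤D with a <? D
    ... | yes _   = refl
    ... | no  a≮D = ≤-antisym (≮⇒≥ a≮D) a≤D

    vertexAt-injective : {u v : Fin (suc D)} → vertexAt D (toℕ u) ≡ vertexAt D (toℕ v) → u ≡ v
    vertexAt-injective {u} {v} eq = toℕ-injective (trans (sym (index-vertexAt (s≤s⁻¹ (toℕ<n u))))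
      (trans (cong index eq) (index-vertexAt (s≤s⁻¹ (toℕ<n v)))))

    gap : ∀ {d l m} → D + l ≤ d + m → D ≤ d + (m ∸ l)
    gap {d} {l} {m} le = +-cancelʳ-≤ l D (d + (m ∸ l)) (≤-trans le (≤-trans
      (+-monoʳ-≤ d (m≤n+m∸n m l)) (≤-reflexive (trans (cong (d +_) (+-comm l (m ∸ l)))
        (sym (+-assoc d (m ∸ l) l))))))

    condition : ∀ u v → u ≢ v →
                suc (diam (spire (suc D) s)) ≤ dist (spire (suc D) s) u v + ∣ label u - label v ∣
    condition u v u≢v = ≤-trans (diam<D 2≤s s<D)
      ([ (λ le → ≤-trans (gap le) (+-monoʳ-≤ d (m≤n⊔m (label u ∸ label v) (label v ∸ label u))))
       , (λ le → ≤-trans (gap le) (+-monoʳ-≤ d (m≤m⊔n (label u ∸ label v) (label v ∸ label u))))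
       ]′ (Ordered⇒Separated ps ordered (proj₂ (labelled (toℕ u))) (proj₂ (labelled (toℕ v)))
            (u≢v ∘ vertexAt-injective) (dist-bounds 2≤s s<D u≢v)))
      where
      d = dist (spire (suc D) s) u v

-- Labelings of spire graphs

-- n = 2k + 1 with k = 2 + K and s = 2 + t.
module Odd (K t : ℕ) where

  -- Here D = 2k. The sums, here and in the other cases, are bracketed so that in `covers` each
  -- interval ends, definitionally, where the next one begins.
  open Separation (2 + t) (K + (2 + (K + 2)))

  -- The order is v_k, v_{2k}, v_1, v_{k+1}, tip, then v_{k+2}, v_2, v_{k+3}, v_3, ..., v_{2k-1},
  -- v_{k-1}.
  pieces : List Piece
  pieces = single (path (K + 2)) 1
         ∷ single (path (K + (2 + (K + 2)))) (3 + K)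
         ∷ single (path 1) (4 + K)
         ∷ single (path (suc (K + 2))) (6 + 2 * K)
         ∷ single tip (8 + 3 * K + t)
         ∷ ladder (2 + (K + 2)) (9 + 4 * K + 2 * t) 2 (11 + 5 * K + 2 * t) (3 + 2 * K) K ∷ []

  -- Although v_{2k} and v_1 are at distance diam, the triples v_k, v_{2k}, v_1 and v_{2k}, v_1,
  -- v_{k+1} fit with slack 0, so no difference has to be raised.
  ordered : Ordered pieces
  ordered =
      tt
    , (ascending 0 (solve (K ∷ t ∷ []))
      , descending 0 (solve (K ∷ t ∷ []))
      , far (pad 2 (solve (K ∷ t ∷ [])))
      , far (pad (4 + K + t) (solve (K ∷ t ∷ [])))
      , (pad (8 + 4 * K + 2 * t) (solve (K ∷ t ∷ []))
      , far (pad (5 + 2 * K + 2 * t) (solve (K ∷ t ∷ [])))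
      , far (pad (7 + 3 * K + 2 * t) (solve (K ∷ t ∷ []))))
      , tt)
    , tt
    , (descending 0 (solve (K ∷ t ∷ []))
      , descending 0 (solve (K ∷ t ∷ []))
      , far (pad (2 + t) (solve (K ∷ t ∷ [])))
      , (pad (6 + 3 * K + 2 * t) (solve (K ∷ t ∷ []))
      , far (pad (3 + K + 2 * t) (solve (K ∷ t ∷ [])))
      , far (pad (5 + 2 * K + 2 * t) (solve (K ∷ t ∷ []))))
      , tt)
    , tt
    , (ascending 0 (solve (K ∷ t ∷ []))
      , far (pad (1 + t) (solve (K ∷ t ∷ [])))
      , (pad (5 + 3 * K + 2 * t) (solve (K ∷ t ∷ []))
      , far (pad (2 + K + 2 * t) (solve (K ∷ t ∷ [])))
      , far (pad (4 + 2 * K + 2 * t) (solve (K ∷ t ∷ []))))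
      , tt)
    , tt
    , (into-tip 0 (solve (K ∷ t ∷ []))
      , (pad (3 + 2 * K + 2 * t) (solve (K ∷ t ∷ []))
      , far (pad (2 * t) (solve (K ∷ t ∷ [])))
      , far (pad (2 + K + 2 * t) (solve (K ∷ t ∷ []))))
      , tt)
    , tt
    , ((pad (1 + K + t) (solve (K ∷ t ∷ []))
      , from-tip-right 0 (solve (K ∷ t ∷ []))
      , far (pad t (solve (K ∷ t ∷ []))))
      , tt)
    , (pad 0 (solve (K ∷ t ∷ []))
      , pad (2 + K) (solve (K ∷ t ∷ []))
      , pad (1 + K) (solve (K ∷ t ∷ []))
      , descending 0 (solve (K ∷ t ∷ []))
      , ascending 0 (solve (K ∷ t ∷ [])))
    , tt
    , tt

  covers : Covers pieces 1 (suc (K + (2 + (K + 2))))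
  covers =
      single-covers (there (there (here refl)))
    ⟫ hi-covers (there (there (there (there (there (here refl))))))
    ⟫ single-covers (here refl)
    ⟫ single-covers (there (there (there (here refl))))
    ⟫ lo-covers (there (there (there (there (there (here refl))))))
    ⟫ single-covers (there (here refl))

  within : Within (8 + 6 * K + 2 * t + 2 * K * K) pieces
  within =
      s≤s z≤n , pad (7 + 6 * K + 2 * t + 2 * K * K) (solve (K ∷ t ∷ []))
    , s≤s z≤n , pad (5 + 5 * K + 2 * t + 2 * K * K) (solve (K ∷ t ∷ []))
    , s≤s z≤n , pad (4 + 5 * K + 2 * t + 2 * K * K) (solve (K ∷ t ∷ []))
    , s≤s z≤n , pad (2 + 4 * K + 2 * t + 2 * K * K) (solve (K ∷ t ∷ []))
    , s≤s z≤n , pad (3 * K + t + 2 * K * K) (solve (K ∷ t ∷ []))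
    , s≤s z≤n , pad (2 + K) (solve (K ∷ t ∷ [])) , pad 0 (solve (K ∷ t ∷ []))
    , tt

  radioNumber≤ : 2 + t < K + (2 + (K + 2)) →
                 RadioNumberAtMost (spire (suc (K + (2 + (K + 2)))) (2 + t))
                   (8 + 6 * K + 2 * t + 2 * K * K)
  radioNumber≤ s<D = radioNumberAtMost pieces (s≤s (s≤s z≤n)) s<D ordered covers
    (_ , there (there (there (there (here refl))))) within

-- n = 2k with k = 4 + K and s = 2 + t.  The label differences are raised by one between
-- v_{2k-1} and the tip, and between v_{k-2} and v_{2k-2}.
module Even (K t : ℕ) where

  open Separation (2 + t) (suc (suc K + suc (suc (suc K + 2))))

  -- The order is v_{k-1}, v_{2k-1}, tip, then v_{k+1}, v_2, ..., v_{2k-3}, v_{k-2}, then v_{2k-2},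
  -- v_1, v_k.
  pieces : List Piece
  pieces = single (path (suc K + 2)) 1
         ∷ single (path (suc (suc K + suc (suc (suc K + 2))))) (4 + K)
         ∷ single tip (6 + K + t)
         ∷ ladder (suc (suc (suc K + 2))) (9 + 2 * K + 2 * t) 2 (13 + 3 * K + 2 * t) (7 + 2 * K) (suc K)
         ∷ single (path (suc K + suc (suc (suc K + 2)))) (17 + 4 * K + 2 * t + K * (7 + 2 * K))
         ∷ single (path 1) (19 + 4 * K + 2 * t + K * (7 + 2 * K))
         ∷ single (path (suc (suc K + 2))) (23 + 5 * K + 2 * t + K * (7 + 2 * K)) ∷ []

  ordered : Ordered pieces
  ordered =
      tt
    , (ascending 0 (solve (K ∷ t ∷ []))
      , into-tip 0 (solve (K ∷ t ∷ []))
      , (pad (8 + 2 * K + 2 * t) (solve (K ∷ t ∷ []))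
      , far (pad (2 + 2 * t) (solve (K ∷ t ∷ [])))
      , far (pad (6 + K + 2 * t) (solve (K ∷ t ∷ []))))
      , far (pad (10 + 9 * K + 2 * t + 2 * K * K) (solve (K ∷ t ∷ [])))
      , far (pad (12 + 9 * K + 2 * t + 2 * K * K) (solve (K ∷ t ∷ [])))
      , far (pad (16 + 10 * K + 2 * t + 2 * K * K) (solve (K ∷ t ∷ [])))
      , tt)
    , tt
    -- The raised difference. It is forced by v_{k-1}, the entry before v_{2k-1}: its own comparison
    -- with the tip has slack 0 only after the raise.
    , (into-tip 1 (solve (K ∷ t ∷ []))
      , (pad (5 + K + 2 * t) (solve (K ∷ t ∷ []))
      , descending (2 * t) (solve (K ∷ t ∷ []))
      , far (pad (3 + 2 * t) (solve (K ∷ t ∷ []))))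
      , far (pad (7 + 8 * K + 2 * t + 2 * K * K) (solve (K ∷ t ∷ [])))
      , far (pad (9 + 8 * K + 2 * t + 2 * K * K) (solve (K ∷ t ∷ [])))
      , far (pad (13 + 9 * K + 2 * t + 2 * K * K) (solve (K ∷ t ∷ [])))
      , tt)
    , tt
    , ((pad (3 + K + t) (solve (K ∷ t ∷ []))
      , from-tip-right 0 (solve (K ∷ t ∷ []))
      , far (pad (1 + t) (solve (K ∷ t ∷ []))))
      , far (pad (5 + 8 * K + t + 2 * K * K) (solve (K ∷ t ∷ [])))
      , far (pad (7 + 8 * K + t + 2 * K * K) (solve (K ∷ t ∷ [])))
      , far (pad (11 + 9 * K + t + 2 * K * K) (solve (K ∷ t ∷ [])))
      , tt)
    , (pad 1 (solve (K ∷ t ∷ []))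
      , pad (4 + K) (solve (K ∷ t ∷ []))
      , pad (3 + K) (solve (K ∷ t ∷ []))
      , descending 0 (solve (K ∷ t ∷ []))
      , ascending 0 (solve (K ∷ t ∷ [])))
    , ((pad (4 + K) (solve (K ∷ t ∷ []))
      , far (pad 2 (solve (K ∷ t ∷ [])))
      -- The other raised difference, forced by v_{k-2} and v_1, which are two places apart and now
      -- fit with slack 0.
      , ascending 1 (solve (K ∷ t ∷ [])))
      , (pad (6 + K) (solve (K ∷ t ∷ []))
      , far (pad 4 (solve (K ∷ t ∷ [])))
      , descending 0 (solve (K ∷ t ∷ [])))
      , (pad (10 + 2 * K) (solve (K ∷ t ∷ []))
      , far (pad (8 + K) (solve (K ∷ t ∷ [])))
      , far (pad 4 (solve (K ∷ t ∷ []))))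
      , tt)
    , tt
    , (descending 0 (solve (K ∷ t ∷ []))
      , descending 1 (solve (K ∷ t ∷ []))
      , tt)
    , tt
    , (ascending 0 (solve (K ∷ t ∷ []))
      , tt)
    , tt
    , tt
    , tt

  covers : Covers pieces 1 (suc (suc (suc K + suc (suc (suc K + 2)))))
  covers =
      single-covers (there (there (there (there (there (here refl))))))
    ⟫ hi-covers (there (there (there (here refl))))
    ⟫ single-covers (here refl)
    ⟫ single-covers (there (there (there (there (there (there (here refl)))))))
    ⟫ lo-covers (there (there (there (here refl))))
    ⟫ single-covers (there (there (there (there (here refl)))))
    ⟫ single-covers (there (here refl))

  within : Within (23 + 5 * K + 2 * t + K * (7 + 2 * K)) pieces
  within =
      s≤s z≤n , pad (22 + 12 * K + 2 * t + 2 * K * K) (solve (K ∷ t ∷ []))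
    , s≤s z≤n , pad (19 + 11 * K + 2 * t + 2 * K * K) (solve (K ∷ t ∷ []))
    , s≤s z≤n , pad (17 + 11 * K + t + 2 * K * K) (solve (K ∷ t ∷ []))
    , s≤s z≤n , pad (4 + K) (solve (K ∷ t ∷ [])) , pad (10 + 2 * K) (solve (K ∷ t ∷ []))
    , s≤s z≤n , pad (6 + K) (solve (K ∷ t ∷ []))
    , s≤s z≤n , pad (4 + K) (solve (K ∷ t ∷ []))
    , s≤s z≤n , pad 0 (solve (K ∷ t ∷ []))
    , tt

  radioNumber≤ : 2 + t < suc (suc K + suc (suc (suc K + 2))) →
                 RadioNumberAtMost (spire (suc (suc (suc K + suc (suc (suc K + 2))))) (2 + t))
                   (23 + 5 * K + 2 * t + K * (7 + 2 * K))
  radioNumber≤ s<D = radioNumberAtMost pieces (s≤s (s≤s z≤n)) s<D ordered covers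
    (_ , there (there (here refl))) within

-- n = 2k with k = 3 + K and s = k - 1.  The label difference between the tip and v_{2k-1} is
-- raised by one.
module Subcentral (K : ℕ) where

  open Separation (2 + K) (suc K + suc (suc (suc K + 1)))

  -- The order is v_k, then v_1, v_{k+1}, ..., v_{k-2}, v_{2k-2}, then tip, v_{2k-1}, v_{k-1}. The
  -- tip takes the place that v_{k-1} would have in the alternation, and v_{k-1} moves to the end.
  pieces : List Piece
  pieces = single (path (suc (suc K + 1))) 1
         ∷ ladder 1 (4 + K) (suc (suc (suc K + 1))) (6 + 2 * K) (5 + 2 * K) (suc K)
         ∷ single tip (8 + 3 * K + K * (5 + 2 * K))
         ∷ single (path (suc K + suc (suc (suc K + 1)))) (10 + 4 * K + K * (5 + 2 * K))
         ∷ single (path (suc K + 1)) (12 + 5 * K + K * (5 + 2 * K)) ∷ []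

  ordered : Ordered pieces
  ordered =
      tt
    , ((pad (3 + K) (solve (K ∷ []))
      , descending 0 (solve (K ∷ []))
      , far (pad 1 (solve (K ∷ []))))
      , far (pad (3 + 6 * K + 2 * K * K) (solve (K ∷ [])))
      , far (pad (5 + 7 * K + 2 * K * K) (solve (K ∷ [])))
      , far (pad (7 + 8 * K + 2 * K * K) (solve (K ∷ [])))
      , tt)
    , (pad 1 (solve (K ∷ []))
      , pad (2 + K) (solve (K ∷ []))
      , pad (3 + K) (solve (K ∷ []))
      , ascending 0 (solve (K ∷ []))
      , descending 0 (solve (K ∷ [])))
    , ((pad (2 + K) (solve (K ∷ []))
      , far (pad 0 (solve (K ∷ [])))
      , into-tip 0 (solve (K ∷ [])))
      , (pad (4 + 2 * K) (solve (K ∷ []))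
      , far (pad (2 + K) (solve (K ∷ [])))
      , far (pad 0 (solve (K ∷ []))))
      , (pad (6 + 3 * K) (solve (K ∷ []))
      , far (pad (4 + 2 * K) (solve (K ∷ [])))
      , far (pad (2 + K) (solve (K ∷ []))))
      , tt)
    , tt
    -- This one raise repairs two triples: v_{2k-2}, tip, v_{2k-1} and tip, v_{2k-1}, v_{k-1}. The
    -- outer vertices of each are adjacent, and both comparisons have slack 0.
    , (from-tip-right 1 (solve (K ∷ []))
      , far (pad 0 (solve (K ∷ [])))
      , tt)
    , tt
    , (descending 0 (solve (K ∷ []))
      , tt)
    , tt
    , tt
    , tt

  covers : Covers pieces 1 (suc (suc K + suc (suc (suc K + 1))))
  covers =
      lo-covers (there (here refl))
    ⟫ single-covers (there (there (there (there (here refl)))))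
    ⟫ single-covers (here refl)
    ⟫ hi-covers (there (here refl))
    ⟫ single-covers (there (there (there (here refl))))

  within : Within (12 + 5 * K + K * (5 + 2 * K)) pieces
  within =
      s≤s z≤n , pad (11 + 10 * K + 2 * K * K) (solve (K ∷ []))
    , s≤s z≤n , pad (2 + K) (solve (K ∷ [])) , pad (6 + 3 * K) (solve (K ∷ []))
    , s≤s z≤n , pad (4 + 2 * K) (solve (K ∷ []))
    , s≤s z≤n , pad (2 + K) (solve (K ∷ []))
    , s≤s z≤n , pad 0 (solve (K ∷ []))
    , tt

  radioNumber≤ : 2 + K < suc K + suc (suc (suc K + 1)) →
                 RadioNumberAtMost (spire (suc (suc K + suc (suc (suc K + 1)))) (2 + K))
                   (12 + 5 * K + K * (5 + 2 * K))
  radioNumber≤ s<D = radioNumberAtMost pieces (s≤s (s≤s z≤n)) s<D ordered covers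
    (_ , there (there (here refl))) within

-- n = 2k with k = s = 2 + K.
module Central (K : ℕ) where

  open Separation (2 + K) (K + suc (suc K + 1))

  -- The order is tip, then v_1, v_{k+1}, ..., v_{k-1}, v_{2k-1}, then v_k. At the end of the list
  -- the tip contributes only one distance, d(tip, v_1) = k.
  pieces : List Piece
  pieces = single tip 1
         ∷ ladder 1 (2 + K) (suc (suc K + 1)) (3 + 2 * K) (3 + 2 * K) (suc K)
         ∷ single (path (suc K + 1)) (5 + 3 * K + K * (3 + 2 * K)) ∷ []

  ordered : Ordered pieces
  ordered =
      tt
    , ((pad (1 + K) (solve (K ∷ []))
      , from-tip-left 0 (solve (K ∷ []))
      , far (pad 0 (solve (K ∷ []))))
      , far (pad (2 + 4 * K + 2 * K * K) (solve (K ∷ [])))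
      , tt)
    , (pad 1 (solve (K ∷ []))
      , pad (1 + K) (solve (K ∷ []))
      , pad (2 + K) (solve (K ∷ []))
      , ascending 0 (solve (K ∷ []))
      , descending 0 (solve (K ∷ [])))
    , ((pad (2 + K) (solve (K ∷ []))
      , far (pad 1 (solve (K ∷ [])))
      , descending 0 (solve (K ∷ [])))
      , tt)
    , tt
    , tt
    , tt

  covers : Covers pieces 1 (suc (K + suc (suc K + 1)))
  covers =
      lo-covers (there (here refl))
    ⟫ single-covers (there (there (here refl)))
    ⟫ hi-covers (there (here refl))

  within : Within (5 + 3 * K + K * (3 + 2 * K)) pieces
  within =
      s≤s z≤n , pad (4 + 6 * K + 2 * K * K) (solve (K ∷ []))
    , s≤s z≤n , pad (1 + K) (solve (K ∷ [])) , pad (2 + K) (solve (K ∷ []))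
    , s≤s z≤n , pad 0 (solve (K ∷ []))
    , tt

  radioNumber≤ : 2 + K < K + suc (suc K + 1) →
                 RadioNumberAtMost (spire (suc (K + suc (suc K + 1))) (2 + K))
                   (5 + 3 * K + K * (3 + 2 * K))
  radioNumber≤ s<D = radioNumberAtMost pieces (s≤s (s≤s z≤n)) s<D ordered covers
    (_ , here refl) within

-- The bounds in terms of n, s and k

transport : ∀ {n n′ B B′} s → n ≡ n′ → B ≡ B′ →
            RadioNumberAtMost (spire n s) B → RadioNumberAtMost (spire n′ s) B′
transport s refl refl r = r

-- Replaces a bound with truncated subtraction by a polynomial identity, which also guarantees that
-- nothing is cut off.
≡-∸ : ∀ {b} m o → b + o ≡ m → b ≡ m ∸ o
≡-∸ {b} m o eq = trans (sym (m+n∸n≡m b o)) (cong (_∸ o) eq)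

s<D : ∀ {n s D} → 2 ≤ s → s ≤ n / 2 → suc D ≡ n → s < D
s<D {n} {s} {D} 2≤s s≤n/2 eq = s≤s⁻¹ (begin
  2 + s     ≤⟨ +-monoˡ-≤ s 2≤s ⟩
  s + s     ≡⟨ solve (s ∷ []) ⟩
  s * 2     ≤⟨ *-monoˡ-≤ 2 s≤n/2 ⟩
  n / 2 * 2 ≤⟨ m/n*n≤m n 2 ⟩
  n         ≡⟨ sym eq ⟩
  suc D     ∎)
  where open ≤-Reasoning

odd-spire : ∀ n s → 4 ≤ n → 2 ≤ s → s ≤ n / 2 → ∀ k → n ≡ 2 * k + 1 →
            RadioNumberAtMost (spire n s) (2 * k * k ∸ 2 * k + 2 * s)
odd-spire _ _ (s≤s ()) _ _ 0 refl
odd-spire _ _ (s≤s (s≤s (s≤s ()))) _ _ 1 refl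
odd-spire n (suc (suc t)) _ 2≤s s≤n/2 (suc (suc K)) n≡ =
  transport (2 + t) size bound (Odd.radioNumber≤ K t (s<D 2≤s s≤n/2 size))
  where
  k = suc (suc K)
  size : suc (K + (2 + (K + 2))) ≡ n
  size = trans eq (sym n≡)
    where
    eq : suc (K + (2 + (K + 2))) ≡ 2 * (2 + K) + 1
    eq = solve (K ∷ [])
  bound : 8 + 6 * K + 2 * t + 2 * K * K ≡ 2 * k * k ∸ 2 * k + 2 * (2 + t)
  bound = trans split (cong (_+ 2 * (2 + t))
            (≡-∸ {b = 4 + 6 * K + 2 * K * K} (2 * k * k) (2 * k) eq))
    where
    split : 8 + 6 * K + 2 * t + 2 * K * K ≡ 4 + 6 * K + 2 * K * K + 2 * (2 + t)
    split = solve (K ∷ t ∷ [])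
    eq : 4 + 6 * K + 2 * K * K + 2 * (2 + K) ≡ 2 * (2 + K) * (2 + K)
    eq = solve (K ∷ [])
odd-spire _ 0 _ () _ (suc (suc _)) _
odd-spire _ 1 _ (s≤s ()) _ (suc (suc _)) _

even-spire : ∀ n s → 2 ≤ s → s ≤ n / 2 → ∀ k → n ≡ 2 * k → s + 2 ≤ k →
             RadioNumberAtMost (spire n s) ((2 * k * k + 2 * s + 3) ∸ 4 * k)
even-spire n s 2≤s s≤n/2 k n≡ s+2≤k
  with m≤n⇒∃[o]m+o≡n 2≤s | m≤n⇒∃[o]m+o≡n (≤-trans (+-monoˡ-≤ 2 2≤s) s+2≤k)
... | t , refl | K , refl =
  transport (2 + t) size (≡-∸ (2 * (4 + K) * (4 + K) + 2 * (2 + t) + 3) (4 * (4 + K)) bound)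
    (Even.radioNumber≤ K t (s<D 2≤s s≤n/2 size))
  where
  size : suc (suc (suc K + suc (suc (suc K + 2)))) ≡ n
  size = trans eq (sym n≡)
    where
    eq : suc (suc (suc K + suc (suc (suc K + 2)))) ≡ 2 * (4 + K)
    eq = solve (K ∷ [])
  bound : 23 + 5 * K + 2 * t + K * (7 + 2 * K) + 4 * (4 + K) ≡
          2 * (4 + K) * (4 + K) + 2 * (2 + t) + 3
  bound = solve (K ∷ t ∷ [])

subcentral-spire : ∀ n s → 2 ≤ s → s ≤ n / 2 → ∀ k → n ≡ 2 * k → s + 1 ≡ k →
                   RadioNumberAtMost (spire n s) (2 * k * k ∸ 2 * k)
subcentral-spire n s 2≤s s≤n/2 _ n≡ refl with m≤n⇒∃[o]m+o≡n 2≤s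
... | K , refl =
  transport (2 + K) size (≡-∸ (2 * (2 + K + 1) * (2 + K + 1)) (2 * (2 + K + 1)) bound)
    (Subcentral.radioNumber≤ K (s<D 2≤s s≤n/2 size))
  where
  size : suc (suc K + suc (suc (suc K + 1))) ≡ n
  size = trans eq (sym n≡)
    where
    eq : suc (suc K + suc (suc (suc K + 1))) ≡ 2 * (2 + K + 1)
    eq = solve (K ∷ [])
  bound : 12 + 5 * K + K * (5 + 2 * K) + 2 * (2 + K + 1) ≡ 2 * (2 + K + 1) * (2 + K + 1)
  bound = solve (K ∷ [])

central-spire : ∀ n s → 2 ≤ s → s ≤ n / 2 → ∀ k → n ≡ 2 * k → s ≡ k →
                RadioNumberAtMost (spire n s) (2 * k * k ∸ 2 * k + 1)
central-spire n s 2≤s s≤n/2 _ n≡ refl with m≤n⇒∃[o]m+o≡n 2≤s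
... | K , refl =
  transport (2 + K) size (trans split (cong (_+ 1) (≡-∸ {b = 4 + 3 * K + K * (3 + 2 * K)}
                      (2 * (2 + K) * (2 + K)) (2 * (2 + K)) bound)))
    (Central.radioNumber≤ K (s<D 2≤s s≤n/2 size))
  where
  size : suc (K + suc (suc K + 1)) ≡ n
  size = trans eq (sym n≡)
    where
    eq : suc (K + suc (suc K + 1)) ≡ 2 * (2 + K)
    eq = solve (K ∷ [])
  split : 5 + 3 * K + K * (3 + 2 * K) ≡ 4 + 3 * K + K * (3 + 2 * K) + 1
  split = solve (K ∷ [])
  bound : 4 + 3 * K + K * (3 + 2 * K) + 2 * (2 + K) ≡ 2 * (2 + K) * (2 + K)
  bound = solve (K ∷ [])

mainTheorem2 : (n s : ℕ) → 4 ≤ n → 2 ≤ s → s ≤ n / 2 → (k : ℕ) →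
    ((n ≡ 2 * k → s + 2 ≤ k → RadioNumberAtMost (spire n s) ((2 * k * k + 2 * s + 3) ∸ 4 * k))
    × (n ≡ 2 * k → s + 1 ≡ k → RadioNumberAtMost (spire n s) (2 * k * k ∸ 2 * k))
    × (n ≡ 2 * k → s ≡ k → RadioNumberAtMost (spire n s) (2 * k * k ∸ 2 * k + 1))
    × (n ≡ 2 * k + 1 → RadioNumberAtMost (spire n s) (2 * k * k ∸ 2 * k + 2 * s)))
mainTheorem2 n s 4≤n 2≤s s≤n/2 k =
    even-spire n s 2≤s s≤n/2 k
  , subcentral-spire n s 2≤s s≤n/2 k
  , central-spire n s 2≤s s≤n/2 k
  , odd-spire n s 4≤n 2≤s s≤n/2 k
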